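{- There is an absolute constant $C>0$ such that for every $\eta>1$ the following holds. Consider the instances of the fractional Online Generalized Assignment Problem satisfying $w_{i,j}\le b_{i,j}\le \eta\, w_{i,j}$ for all $(i,j)\in E$. Then every online algorithm has worst-case competitive ratio at most $\frac{C}{\log \eta}$ on this class of instances; that is, the worst-case competitive ratio of online algorithms on these instances is bounded above by $O\bigl(\frac{1}{\log\eta}\bigr)$.
   Context: Online Generalized Assignment Problem (OnGAP, fractional): an instance consists of a finite bipartite graph $(L\cup R,E)$, where $L$ is a set of buyers with budgets $B_i>0$ known in advance and $R$ is a set of items arriving online one by one. When item $j$ arrives, its set of neighboring buyers $N(j)\subseteq L$, the bids $b_{i,j}$ and the weights $w_{i,j}>0$ for $i\in N(j)$ are revealed, and the online algorithm must irrevocably choose $x_{i,j}\ge 0$ for $i\in N(j)$ without knowledge of future items (including their number), maintaining feasibility. A feasible fractional allocation satisfies $x_{i,j}\ge 0$, $\sum_{j\in N(i)}w_{i,j}x_{i,j}\le B_i$ for all $i\in L$, and $\sum_{i\in N(j)}x_{i,j}\le 1$ for all $j\in R$; its value is $\sum_{(i,j)\in E}b_{i,j}x_{i,j}$. Allocations cannot be revoked (no free disposal). $\mathrm{OPT}(I)$ denotes the maximum value of a feasible fractional allocation of instance $I$. The worst-case competitive ratio of an online algorithm on a class of instances is the infimum, over instances $I$ in the class (including the arrival order) with $\mathrm{OPT}(I)>0$, of $\mathrm{ALG}(I)/\mathrm{OPT}(I)$, where $\mathrm{ALG}(I)$ is the (expected) value of the allocation produced by the algorithm on $I$. -}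

module Defs where

open import Algebra.Apartness.Bundles using (HeytingField; HeytingCommutativeRing)
open import Algebra.Bundles using (CommutativeRing; Semiring)
import Algebra.Definitions.RawSemiring as RawSemiring
open import Data.Fin.Base using (Fin; toℕ)
open import Data.Fin.Subset using (Subset; _∈_)
open import Data.Fin.Subset.Properties using (_∈?_)
open import Data.List.Base using (List; length; lookup; take)
open import Data.Nat.Base as ℕ using (ℕ; zero; suc; _!; NonZero)
open import Data.Nat.Properties using (_!≢0)
open import Data.Product.Base using (Σ; ∃-syntax; _×_; proj₁)
open import Data.Sum.Base using (_⊎_; inj₁; inj₂)
open import Function.Bundles using (_⇔_; Equivalence)
open import Level using (0ℓ)
open import Relation.Binary.Core using (Rel)
open import Relation.Binary.Structures using (IsStrictPartialOrder)
open import Relation.Nullary using (¬_; Dec; yes; no)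
open import Relation.Unary using (Pred; Decidable)

-- The real numbers: a Cauchy complete Archimedean ordered field, which
-- determines them up to isomorphism.  The axioms are the constructive ones
-- (no decidability of the order); Bishop's reals satisfy them, and so do the
-- classical reals in the presence of excluded middle.

record RealField : Set₁ where
  infix 4 _<_ _≤_
  field
    heytingField : HeytingField 0ℓ 0ℓ 0ℓ

  open HeytingField heytingField public
    renaming (Carrier to ℝ)

  commutativeRing : CommutativeRing 0ℓ 0ℓ
  commutativeRing = HeytingCommutativeRing.commutativeRing heytingCommutativeRing

  semiring : Semiring 0ℓ 0ℓ
  semiring = CommutativeRing.semiring commutativeRing

  field
    _<_                  : Rel ℝ 0ℓ
    isStrictPartialOrder : IsStrictPartialOrder _≈_ _<_
    #⇔<⊎>                : ∀ {x y} → x # y ⇔ (x < y ⊎ y < x)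
    0<1                  : 0# < 1#
    +-monoˡ-<            : ∀ {x y} z → x < y → x + z < y + z
    *-pos                : ∀ {x y} → 0# < x → 0# < y → 0# < x * y

  open RawSemiring (Semiring.rawSemiring semiring) public
    using (sum; _^_)
    renaming (_×_ to _⨰_)

  fromℕ : ℕ → ℝ
  fromℕ n = n ⨰ 1#

  _≤_ : Rel ℝ 0ℓ
  x ≤ y = ¬ (y < x)

  -- ∣ x - y ∣ < ε
  _≈[_]_ : ℝ → ℝ → ℝ → Set
  x ≈[ ε ] y = (x - y < ε) × (y - x < ε)

  Cauchy : Pred (ℕ → ℝ) 0ℓ
  Cauchy s = ∀ ε → 0# < ε →
    ∃[ N ] ∀ m n → N ℕ.≤ m → N ℕ.≤ n → s m ≈[ ε ] s n

  _⟶_ : (ℕ → ℝ) → ℝ → Set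
  s ⟶ x = ∀ ε → 0# < ε → ∃[ N ] ∀ n → N ℕ.≤ n → s n ≈[ ε ] x

  field
    archimedean : ∀ x → ∃[ n ] x < fromℕ n
    complete    : ∀ s → Cauchy s → ∃[ x ] s ⟶ x

  open IsStrictPartialOrder isStrictPartialOrder public
    using (<-resp-≈; <-respʳ-≈; <-respˡ-≈)
    renaming (irrefl to <-irrefl; trans to <-trans)

  -- #⇒invertible produces the inverse of y - 0#.
  _/_[_] : (x y : ℝ) → 0# < y → ℝ
  x / y [ 0<y ] =
    x * proj₁ (#⇒invertible (Equivalence.from #⇔<⊎> (inj₂ 0<y)))

  fromℕ-pos : ∀ n .{{_ : NonZero n}} → 0# < fromℕ n
  fromℕ-pos (suc zero)    = <-respʳ-≈ (sym (+-identityʳ 1#)) 0<1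
  fromℕ-pos (suc (suc n)) = <-trans (fromℕ-pos (suc n))
    (<-respˡ-≈ (+-identityˡ _) (+-monoˡ-< (fromℕ (suc n)) 0<1))

  expPartialSum : ℝ → ℕ → ℝ
  expPartialSum x n = sum {n} λ k →
    (x ^ toℕ k) / fromℕ (toℕ k !) [ fromℕ-pos (toℕ k !) {{toℕ k !≢0}} ]

  -- l is the natural logarithm of x, i.e. exp l = x.
  IsLog : ℝ → ℝ → Set
  IsLog l x = expPartialSum l ⟶ x

  -- inf S ≤ c.  No real number inf S is presupposed: whenever S has an
  -- infimum, this says that it is at most c.
  Inf_AtMost_ : Pred ℝ 0ℓ → ℝ → Set
  Inf S AtMost c = ∀ ε → 0# < ε → ∃[ s ] S s × s < c + ε

module OnGAP (R : RealField) where
  open RealField R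

  ∑ : ∀ {n} {P : Pred (Fin n) 0ℓ} → Decidable P → (∀ k → P k → ℝ) → ℝ
  ∑ {P = P} P? f = sum λ k → term k (P? k)
    where
    term : ∀ k → Dec (P k) → ℝ
    term k (yes p) = f k p
    term k (no _)  = 0#

  -- An item, as revealed upon arrival, for n buyers.
  record Item (n : ℕ) : Set where
    field
      N        : Subset n
      bid      : ∀ i → i ∈ N → ℝ
      weight   : ∀ i → i ∈ N → ℝ
      weight>0 : ∀ i (e : i ∈ N) → 0# < weight i e

  -- The items are listed in their order of arrival.
  record Instance : Set where
    field
      {buyers} : ℕ
      budget   : Fin buyers → ℝ
      budget>0 : ∀ i → 0# < budget i
      items    : List (Item buyers)

    Position : Set
    Position = Fin (length items)

    item : Position → Item buyers
    item = lookup items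

    Edge : Fin buyers → Position → Set
    Edge i j = i ∈ Item.N (item j)

    edge? : ∀ i j → Dec (Edge i j)
    edge? i j = i ∈? Item.N (item j)

    b w : ∀ i j → Edge i j → ℝ
    b i j = Item.bid (item j) i
    w i j = Item.weight (item j) i

    Allocation : Set
    Allocation = ∀ i j → Edge i j → ℝ

    record Feasible (x : Allocation) : Set where
      field
        nonNegative  : ∀ i j e → 0# ≤ x i j e
        withinBudget : ∀ i → ∑ (edge? i) (λ j e → w i j e * x i j e) ≤ budget i
        atMostOnce   : ∀ j → ∑ (λ i → edge? i j) (λ i e → x i j e) ≤ 1#

    value : Allocation → ℝ
    value x = sum λ j → ∑ (λ i → edge? i j) (λ i e → b i j e * x i j e)

    record IsOPT (v : ℝ) : Set where
      field
        attained   : ∃[ x ] Feasible x × value x ≈ v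
        upperBound : ∀ x → Feasible x → value x ≤ v

  -- Bids between weight and η times weight.
  InClass : ℝ → Instance → Set
  InClass η I = ∀ i j e → (w i j e ≤ b i j e) × (b i j e ≤ η * w i j e)
    where open Instance I

  -- The random seed of an algorithm, through its expectation operator.  Every
  -- probability space gives one, taking its integrable random variables;
  -- countable additivity is not demanded.  A one-point space gives the
  -- deterministic algorithms.
  record Randomness : Set₁ where
    field
      Outcome    : Set
      Integrable : Pred (Outcome → ℝ) 0ℓ
      const-int  : ∀ c → Integrable (λ _ → c)
      +-int      : ∀ {f g} → Integrable f → Integrable g →
                   Integrable (λ ω → f ω + g ω)
      *-int      : ∀ c {f} → Integrable f → Integrable (λ ω → c * f ω)

      𝔼          : ∀ f → Integrable f → ℝ
      𝔼-const    : ∀ c → 𝔼 _ (const-int c) ≈ c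
      𝔼-+        : ∀ {f g} (p : Integrable f) (q : Integrable g) →
                   𝔼 _ (+-int p q) ≈ 𝔼 f p + 𝔼 g q
      𝔼-*        : ∀ c {f} (p : Integrable f) → 𝔼 _ (*-int c p) ≈ c * 𝔼 f p
      𝔼-mono     : ∀ {f g} (p : Integrable f) (q : Integrable g) →
                   (∀ ω → f ω ≤ g ω) → 𝔼 f p ≤ 𝔼 g q

  -- For a fixed outcome of the seed, the decision on an arriving item is a
  -- function of the budgets, the items that came before (which determine the
  -- earlier decisions) and the item itself.
  Strategy : Set
  Strategy = ∀ {n} (budget : Fin n → ℝ) (past : List (Item n))
             (current : Item n) → ∀ i → i ∈ Item.N current → ℝ

  run : Strategy → ∀ I → Instance.Allocation I
  run decide I i j = decide budget (take (toℕ j) items) (item j) i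
    where open Instance I

  -- A randomized algorithm for the class with parameter η, on which alone it
  -- has to be feasible; it may depend on η.
  record OnlineAlgorithm (η : ℝ) : Set₁ where
    field
      randomness : Randomness
    open Randomness randomness
    field
      strategy   : Outcome → Strategy
      feasible   : ∀ ω I → InClass η I → Instance.Feasible I (run (strategy ω) I)
      integrable : ∀ I → InClass η I →
                   Integrable (λ ω → Instance.value I (run (strategy ω) I))

    ALG : ∀ I → InClass η I → ℝ
    ALG I I∈ = 𝔼 _ (integrable I I∈)

  -- The set of the values ALG(I) / OPT(I) over the I in the class with
  -- OPT(I) > 0; its infimum is the worst-case competitive ratio.
  Ratios : ∀ {η} → OnlineAlgorithm η → Pred ℝ 0ℓ
  Ratios {η} A r =
    ∃[ I ] Σ (InClass η I) λ I∈ → ∃[ v ] Instance.IsOPT I v ×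
    Σ (0# < v) λ 0<v → r ≈ OnlineAlgorithm.ALG A I I∈ / v [ 0<v ]

-- One buyer with budget 1 meets items of weight 1 and bids 1, 2, 4, ..., 2 ^ K,
-- where 2 ^ K < η < 2 ^ (K + 2).  On the first k + 1 of them OPT is 2 ^ k, and
-- an algorithm that gives the share x m to item m gains the sum of 2 ^ m x m
-- over m ≤ k.  So item m contributes at most x m (1 + 1/2 + 1/4 + ...) ≤ 2 x m
-- to the sum of the ratios over all K + 1 prefixes, and as the shares add up to
-- at most 1, some expected ratio exceeds 2 / (K + 1) by less than any given ε > 0
-- (the order is not decidable, hence the ε).  Finally
-- log η ≤ K + 2 ≤ 2 (K + 1), since exp n ≥ 2 ^ n: by Bernoulli's inequality, the
-- partial sums of the exponential series at least double when both the argument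
-- and the number of terms grow by one.
module Submission where

open import Algebra.Bundles using (CommutativeRing)
open import Algebra.Apartness.Properties.HeytingCommutativeRing
  using (invertibleˡ⇒#; x-0≈x)
import Algebra.Properties.CommutativeMonoid.Sum as MonoidSum
import Algebra.Properties.Semiring.Exp as Exp
import Algebra.Properties.Semiring.Mult as Mult
import Algebra.Solver.Ring.NaturalCoefficients.Default as Solver
open import Data.Empty using (⊥-elim)
open import Data.Fin.Base using (Fin; zero; suc; toℕ; inject₁; fromℕ<)
import Data.Fin.Base as Fin
open import Data.Fin.Properties using (toℕ-inject₁; toℕ-fromℕ; toℕ-fromℕ<; toℕ<n)
open import Data.Fin.Subset using (_∈_; ⊤)
open import Data.Fin.Subset.Properties using (∈⊤)
open import Data.List.Base using (_∷_; length; take; applyUpTo)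
open import Data.List.Properties using (length-applyUpTo; lookup-applyUpTo)
open import Data.Nat.Base as ℕ using (ℕ; zero; suc; _!; s≤s⁻¹)
import Data.Nat.Properties as ℕ
open import Data.Product.Base using (Σ; _×_; _,_; ∃-syntax; proj₁; proj₂)
open import Data.Sum.Base using (_⊎_; inj₁; inj₂)
open import Data.Vec.Base using (here; there)
open import Defs
open import Function.Base using (_∘_)
open import Function.Bundles using (Equivalence)
open import Level using (0ℓ)
import Relation.Binary.Reasoning.Base.Triple as Triple
open import Relation.Binary.PropositionalEquality.Core as ≡ using (_≡_)
open import Relation.Binary.Structures using (IsPreorder; IsStrictPartialOrder)
open import Relation.Nullary using (¬_; yes; no)
open import Relation.Unary using (Pred; Decidable)

-- Arithmetic and order of a constructive ordered field

module OrderedField (R : RealField) where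
  open RealField R hiding (zero)
  open CommutativeRing commutativeRing using (+-commutativeMonoid)
  open MonoidSum +-commutativeMonoid using (sum-cong-≗; sum-init-last)

  private variable
    x y z u v : ℝ

  -- Inherited from the cotransitivity of apartness. It is the substitute for deciding the order in
  -- every search below.
  <-cotrans : x < y → ∀ z → x < z ⊎ z < y
  <-cotrans x<y z with #-cotrans (Equivalence.from #⇔<⊎> (inj₁ x<y)) z
  <-cotrans x<y z | inj₁ x#z with Equivalence.to #⇔<⊎> x#z
  ... | inj₁ x<z = inj₁ x<z
  ... | inj₂ z<x = inj₂ (<-trans z<x x<y)
  <-cotrans x<y z | inj₂ z#y with Equivalence.to #⇔<⊎> z#y
  ... | inj₁ z<y = inj₂ z<y
  ... | inj₂ y<z = inj₁ (<-trans x<y y<z)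

  <⇒≤ : x < y → x ≤ y
  <⇒≤ x<y y<x = <-irrefl refl (<-trans x<y y<x)

  <-≤-trans : x < y → y ≤ z → x < z
  <-≤-trans {z = z} x<y y≤z with <-cotrans x<y z
  ... | inj₁ x<z = x<z
  ... | inj₂ z<y = ⊥-elim (y≤z z<y)

  ≤-<-trans : x ≤ y → y < z → x < z
  ≤-<-trans {x = x} x≤y y<z with <-cotrans y<z x
  ... | inj₁ y<x = ⊥-elim (x≤y y<x)
  ... | inj₂ x<z = x<z

  ≤-isPreorder : IsPreorder _≈_ _≤_
  ≤-isPreorder = record
    { isEquivalence = isEquivalence
    ; reflexive     = λ x≈y → <-irrefl (sym x≈y)
    ; trans         = λ x≤y y≤z z<x → y≤z (<-≤-trans z<x x≤y)
    }

  open IsPreorder ≤-isPreorder public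
    using () renaming (refl to ≤-refl; reflexive to ≤-reflexive; trans to ≤-trans)

  module ≤-Reasoning = Triple ≤-isPreorder
    (IsStrictPartialOrder.asym isStrictPartialOrder)
    <-trans <-resp-≈ <⇒≤ <-≤-trans ≤-<-trans

  open ≤-Reasoning

  ≤-respˡ-≈ : x ≈ y → x ≤ z → y ≤ z
  ≤-respˡ-≈ x≈y x≤z = ≤-trans (≤-reflexive (sym x≈y)) x≤z

  x+z-z≈x : ∀ x z → (x + z) - z ≈ x
  x+z-z≈x x z = trans (+-assoc x z (- z))
    (trans (+-congˡ (-‿inverseʳ z)) (+-identityʳ x))

  x-z+z≈x : ∀ x z → (x - z) + z ≈ x
  x-z+z≈x x z = trans (+-assoc x (- z) z)
    (trans (+-congˡ (-‿inverseˡ z)) (+-identityʳ x))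

  +-cancelʳ-< : ∀ z → x + z < y + z → x < y
  +-cancelʳ-< z =
    <-respʳ-≈ (x+z-z≈x _ z) ∘ <-respˡ-≈ (x+z-z≈x _ z) ∘ +-monoˡ-< (- z)

  +-monoʳ-< : ∀ z → x < y → z + x < z + y
  +-monoʳ-< z x<y =
    <-respʳ-≈ (+-comm _ z) (<-respˡ-≈ (+-comm _ z) (+-monoˡ-< z x<y))

  -- As `≤` is a negated `<`, monotonicity of `≤` is the contrapositive of cancellation for `<`;
  -- likewise for products.
  +-monoˡ-≤ : ∀ z → x ≤ y → x + z ≤ y + z
  +-monoˡ-≤ z x≤y = x≤y ∘ +-cancelʳ-< z

  +-monoʳ-≤ : ∀ z → x ≤ y → z + x ≤ z + y
  +-monoʳ-≤ {x} {y} z x≤y = begin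
    z + x ≈⟨ +-comm z x ⟩
    x + z ≤⟨ +-monoˡ-≤ z x≤y ⟩
    y + z ≈⟨ +-comm y z ⟩
    z + y ∎

  +-mono-≤ : x ≤ y → u ≤ v → x + u ≤ y + v
  +-mono-≤ x≤y u≤v = ≤-trans (+-monoˡ-≤ _ x≤y) (+-monoʳ-≤ _ u≤v)

  x≤x+y : 0# ≤ y → x ≤ x + y
  x≤x+y 0≤y = ≤-respˡ-≈ (+-identityʳ _) (+-monoʳ-≤ _ 0≤y)

  x<x+y : 0# < y → x < x + y
  x<x+y 0<y = <-respˡ-≈ (+-identityʳ _) (+-monoʳ-< _ 0<y)

  x<y⇒0<y-x : x < y → 0# < y - x
  x<y⇒0<y-x {x} x<y = <-respˡ-≈ (-‿inverseʳ x) (+-monoˡ-< (- x) x<y)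

  *-monoʳ-< : 0# < z → x < y → z * x < z * y
  *-monoʳ-< {z} {x} {y} 0<z x<y = begin-strict
    z * x                   <⟨ x<x+y (*-pos 0<z (x<y⇒0<y-x x<y)) ⟩
    z * x + z * (y - x)     ≈⟨ distribˡ z x (y - x) ⟨
    z * (x + (y - x))       ≈⟨ *-congˡ (trans (+-comm x _) (x-z+z≈x y x)) ⟩
    z * y                   ∎

  recip : ∀ x → 0# < x → ℝ
  recip x 0<x = proj₁ (#⇒invertible (Equivalence.from #⇔<⊎> (inj₂ 0<x)))

  recip-inverseʳ : (0<x : 0# < x) → x * recip x 0<x ≈ 1#
  recip-inverseʳ {x} 0<x = trans (*-congʳ x≈x-0) (proj₂ (proj₂ inv))
    where
    inv = #⇒invertible (Equivalence.from #⇔<⊎> (inj₂ 0<x))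
    x≈x-0 : x ≈ x - 0#
    x≈x-0 = trans (sym (x-z+z≈x x 0#)) (+-identityʳ _)

  recip-inverseˡ : (0<x : 0# < x) → recip x 0<x * x ≈ 1#
  recip-inverseˡ 0<x = trans (*-comm _ _) (recip-inverseʳ 0<x)

  -- The reciprocal is itself invertible, hence apart from 0; if it were negative, multiplying by
  -- `x` would give `1 < 0`.
  recip-pos : (0<x : 0# < x) → 0# < recip x 0<x
  recip-pos {x} 0<x with Equivalence.to #⇔<⊎> r#0
    where
    r#0 : recip x 0<x # 0#
    r#0 = invertibleˡ⇒# heytingCommutativeRing
      (x , trans (*-congˡ (x-0≈x heytingCommutativeRing _)) (recip-inverseʳ 0<x))
  ... | inj₂ 0<r = 0<r
  ... | inj₁ r<0 = ⊥-elim (<-irrefl refl (<-trans 0<1 1<0))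
    where
    1<0 : 1# < 0#
    1<0 = <-respʳ-≈ (zeroʳ x)
      (<-respˡ-≈ (recip-inverseʳ 0<x) (*-monoʳ-< 0<x r<0))

  recip-cancel : (0<z : 0# < z) → ∀ x → recip z 0<z * (z * x) ≈ x
  recip-cancel 0<z x = trans (sym (*-assoc _ _ x))
    (trans (*-congʳ (recip-inverseˡ 0<z)) (*-identityˡ x))

  *-cancelˡ-< : 0# < z → z * x < z * y → x < y
  *-cancelˡ-< 0<z = <-respʳ-≈ (recip-cancel 0<z _)
    ∘ <-respˡ-≈ (recip-cancel 0<z _) ∘ *-monoʳ-< (recip-pos 0<z)

  *-cancelˡ-≈ : 0# < z → z * x ≈ z * y → x ≈ y
  *-cancelˡ-≈ 0<z zx≈zy = trans (sym (recip-cancel 0<z _))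
    (trans (*-congˡ zx≈zy) (recip-cancel 0<z _))

  *-monoʳ-≤ : 0# < z → x ≤ y → z * x ≤ z * y
  *-monoʳ-≤ 0<z x≤y = x≤y ∘ *-cancelˡ-< 0<z

  *-cancelˡ-≤ : 0# < z → z * x ≤ z * y → x ≤ y
  *-cancelˡ-≤ 0<z zx≤zy = zx≤zy ∘ *-monoʳ-< 0<z

  ≤-antisym : x ≤ y → y ≤ x → x ≈ y
  ≤-antisym {x} {y} x≤y y≤x = proj₁ (tight x y) (not-apart ∘ Equivalence.to #⇔<⊎>)
    where
    not-apart : ¬ (x < y ⊎ y < x)
    not-apart (inj₁ x<y) = y≤x x<y
    not-apart (inj₂ y<x) = x≤y y<x

  -- The goal is a negation, so the cases x > 0 and x ≈ 0 are exhaustive.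
  *-nonNeg : 0# ≤ x → 0# ≤ y → 0# ≤ x * y
  *-nonNeg {x} {y} 0≤x 0≤y xy<0 = <-irrefl xy≈0 xy<0
    where
    x≤0 : x ≤ 0#
    x≤0 0<x = ≤-respˡ-≈ (zeroʳ x) (*-monoʳ-≤ 0<x 0≤y) xy<0
    xy≈0 : x * y ≈ 0#
    xy≈0 = trans (*-congʳ (≤-antisym x≤0 0≤x)) (zeroˡ y)

  *-monoˡ-≤-nonNeg : 0# ≤ z → x ≤ y → x * z ≤ y * z
  *-monoˡ-≤-nonNeg {z} {x} {y} 0≤z x≤y = begin
    x * z               ≤⟨ x≤x+y (*-nonNeg 0≤y-x 0≤z) ⟩
    x * z + (y - x) * z ≈⟨ distribʳ z x (y - x) ⟨
    (x + (y - x)) * z   ≈⟨ *-congʳ (trans (+-comm x _) (x-z+z≈x y x)) ⟩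
    y * z               ∎
    where
    0≤y-x : 0# ≤ y - x
    0≤y-x = ≤-respˡ-≈ (-‿inverseʳ x) (+-monoˡ-≤ (- x) x≤y)

  0≤fromℕ : ∀ n → 0# ≤ fromℕ n
  0≤fromℕ zero    = ≤-refl
  0≤fromℕ (suc n) = <⇒≤ (fromℕ-pos (suc n))

  -- Finite sums and the averaging argument

  sum-mono-≤ : ∀ {n} {f g : Fin n → ℝ} → (∀ k → f k ≤ g k) → sum f ≤ sum g
  sum-mono-≤ {zero}  f≤g = ≤-refl
  sum-mono-≤ {suc n} f≤g = +-mono-≤ (f≤g zero) (sum-mono-≤ (f≤g ∘ suc))

  *-distribˡ-sum : ∀ x {n} (f : Fin n → ℝ) → x * sum f ≈ sum λ k → x * f k
  *-distribˡ-sum x {zero}  f = zeroʳ x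
  *-distribˡ-sum x {suc n} f =
    trans (distribˡ x _ _) (+-congˡ (*-distribˡ-sum x (f ∘ suc)))

  sum-<⇒∃-< : ∀ {n} (f g : Fin n → ℝ) → sum f < sum g → ∃[ k ] f k < g k
  sum-<⇒∃-< {zero}  f g 0<0 = ⊥-elim (<-irrefl refl 0<0)
  -- The mixed sum has its head from `g` and its tail from `f`. If it exceeds the sum of `f`, the
  -- heads differ; if it is below the sum of `g`, the tails do.
  sum-<⇒∃-< {suc n} f g f<g with <-cotrans f<g (g zero + sum (f ∘ suc))
  ... | inj₁ f₀<g₀ = zero , +-cancelʳ-< _ f₀<g₀
  ... | inj₂ tail< with sum-<⇒∃-< (f ∘ suc) (g ∘ suc)
                          (+-cancelʳ-< (g zero) (<-respʳ-≈ (+-comm _ _)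
                            (<-respˡ-≈ (+-comm _ _) tail<)))
  ... | k , fk<gk = suc k , fk<gk

  -- Splits off the last term, whereas `sum` splits off the first, so that inductions can lengthen a
  -- prefix.
  sumTo : (ℕ → ℝ) → ℕ → ℝ
  sumTo f zero    = 0#
  sumTo f (suc n) = sumTo f n + f n

  sum-toℕ : ∀ f n → sum {n} (f ∘ toℕ) ≈ sumTo f n
  sum-toℕ f zero    = refl
  sum-toℕ f (suc n) = begin-equality
    sum {suc n} (f ∘ toℕ)
      ≈⟨ sum-init-last {n} (f ∘ toℕ) ⟩
    sum {n} (f ∘ toℕ ∘ inject₁) + f (toℕ (Fin.fromℕ n))
      ≡⟨ ≡.cong₂ _+_ (sum-cong-≗ {n} (λ k → ≡.cong f (toℕ-inject₁ k)))
                     (≡.cong f (toℕ-fromℕ n)) ⟩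
    sum {n} (f ∘ toℕ) + f n
      ≈⟨ +-congʳ (sum-toℕ f n) ⟩
    sumTo f (suc n) ∎

  sumTo-cong : ∀ {f g} n → (∀ k → k ℕ.< n → f k ≈ g k) → sumTo f n ≈ sumTo g n
  sumTo-cong zero    f≈g = refl
  sumTo-cong (suc n) f≈g =
    +-cong (sumTo-cong n λ k k<n → f≈g k (ℕ.m<n⇒m<1+n k<n)) (f≈g n ℕ.≤-refl)

  sumTo-zero : ∀ n → sumTo (λ _ → 0#) n ≈ 0#
  sumTo-zero zero    = refl
  sumTo-zero (suc n) = trans (+-identityʳ _) (sumTo-zero n)

  sumTo-nonNeg : ∀ {f} n → (∀ k → k ℕ.< n → 0# ≤ f k) → 0# ≤ sumTo f n
  sumTo-nonNeg zero    0≤f = ≤-refl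
  sumTo-nonNeg (suc n) 0≤f =
    ≤-trans (sumTo-nonNeg n λ k k<n → 0≤f k (ℕ.m<n⇒m<1+n k<n))
            (x≤x+y (0≤f n ℕ.≤-refl))

  -- Powers of two

  2# : ℝ
  2# = 1# + 1#

  0<2 : 0# < 2#
  0<2 = <-trans 0<1 (x<x+y 0<1)

  2*x≈x+x : ∀ x → 2# * x ≈ x + x
  2*x≈x+x x = trans (distribʳ x 1# 1#) (+-cong (*-identityˡ x) (*-identityˡ x))

  ^-pos : 0# < x → ∀ n → 0# < x ^ n
  ^-pos 0<x zero    = 0<1
  ^-pos 0<x (suc n) = *-pos 0<x (^-pos 0<x n)

  0<2^ : ∀ n → 0# < 2# ^ n
  0<2^ = ^-pos 0<2

  2^-suc : ∀ n → 2# ^ suc n ≈ 2# ^ n + 2# ^ n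
  2^-suc n = 2*x≈x+x (2# ^ n)

  2^n<2^[1+n] : ∀ n → 2# ^ n < 2# ^ suc n
  2^n<2^[1+n] n = <-respʳ-≈ (sym (2^-suc n)) (x<x+y (0<2^ n))

  2^-mono-≤ : ∀ {m n} → m ℕ.≤ n → 2# ^ m ≤ 2# ^ n
  2^-mono-≤ m≤n = go (ℕ.≤⇒≤′ m≤n)
    where
    go : ∀ {m n} → m ℕ.≤′ n → 2# ^ m ≤ 2# ^ n
    go (ℕ.≤′-reflexive ≡.refl) = ≤-refl
    go {n = suc n} (ℕ.≤′-step m≤n) = ≤-trans (go m≤n) (<⇒≤ (2^n<2^[1+n] n))

  fromℕ<2^ : ∀ n → fromℕ n < 2# ^ n
  fromℕ<2^ zero    = 0<1
  fromℕ<2^ (suc n) = begin-strict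
    1# + fromℕ n    <⟨ +-monoʳ-< 1# (fromℕ<2^ n) ⟩
    1# + 2# ^ n     ≤⟨ +-monoˡ-≤ _ (2^-mono-≤ {0} {n} ℕ.z≤n) ⟩
    2# ^ n + 2# ^ n ≈⟨ 2^-suc n ⟨
    2# ^ suc n      ∎

  -- The gap of two in the exponents makes K computable without deciding <.
  dyadicBounds : ∀ x → 1# < x → ∃[ K ] 2# ^ K < x × x < 2# ^ (2 ℕ.+ K)
  dyadicBounds x 1<x with archimedean x
  ... | N , x<N = search N 0 1<x
          (<-trans x<N (≡.subst (λ n → fromℕ N < 2# ^ n)
            (≡.sym (ℕ.+-identityʳ N)) (fromℕ<2^ N)))
    where
    -- The counter `d` is the distance between the exponents of the two known bounds; at distance 0
    -- they contradict each other.
    search : ∀ d k → 2# ^ k < x → x < 2# ^ (d ℕ.+ k) →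
             ∃[ K ] 2# ^ K < x × x < 2# ^ (2 ℕ.+ K)
    search zero    k 2^k<x x<2^k = ⊥-elim (<-irrefl refl (<-trans 2^k<x x<2^k))
    search (suc d) k 2^k<x x<2^  with <-cotrans (2^n<2^[1+n] (suc k)) x
    ... | inj₂ x<2^[2+k] = k , 2^k<x , x<2^[2+k]
    ... | inj₁ 2^[1+k]<x = search d (suc k) 2^[1+k]<x
            (≡.subst (λ n → x < 2# ^ n) (≡.sym (ℕ.+-suc d k)) x<2^)

-- The exponential series and an upper bound for the logarithm

module Logarithm (R : RealField) where
  open RealField R hiding (zero)
  open OrderedField R
  open CommutativeRing commutativeRing using (commutativeSemiring)
  open Exp semiring using (^-congˡ)
  open Mult semiring using (×1-homo-*)
  open Solver commutativeSemiring using (solve; _:+_; _:*_; _:=_)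
  open ≤-Reasoning

  private variable
    x y : ℝ

  0<! : ∀ k → 0# < fromℕ (k !)
  0<! k = fromℕ-pos (k !) {{k ℕ.!≢0}}

  -- Definitionally the summand of `expPartialSum`, so `sum-toℕ` applies to the partial sums as they
  -- are.
  expTerm : ℝ → ℕ → ℝ
  expTerm y k = (y ^ k) / fromℕ (k !) [ 0<! k ]

  !*expTerm : ∀ y k → fromℕ (k !) * expTerm y k ≈ y ^ k
  !*expTerm y k = begin-equality
    F * (y ^ k * r) ≈⟨ solve 3 (λ F p r → F :* (p :* r) := (F :* r) :* p)
                         refl F (y ^ k) r ⟩
    (F * r) * y ^ k ≈⟨ *-congʳ (recip-inverseʳ (0<! k)) ⟩
    1# * y ^ k      ≈⟨ *-identityˡ _ ⟩
    y ^ k           ∎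
    where
    F = fromℕ (k !)
    r = recip F (0<! k)

  expTerm-cong : x ≈ y → ∀ k → expTerm x k ≈ expTerm y k
  expTerm-cong x≈y k = *-congʳ (^-congˡ k x≈y)

  expTerm-nonNeg : 0# < y → ∀ k → 0# ≤ expTerm y k
  expTerm-nonNeg 0<y k = <⇒≤ (*-pos (^-pos 0<y k) (recip-pos (0<! k)))

  -- Homogeneous Bernoulli inequality: the left side consists of the two leading terms of the
  -- binomial expansion. Multiplying the induction hypothesis by `y + 1` leaves the surplus `n * p`,
  -- which is dropped.
  bernoulli : 0# < y → ∀ k →
    y ^ suc k + fromℕ (suc k) * y ^ k ≤ (y + 1#) ^ suc k
  bernoulli {y} 0<y zero = ≤-reflexive (trans
    (+-congˡ (*-congʳ (+-identityʳ 1#))) (sym (distribʳ 1# y 1#)))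
  bernoulli {y} 0<y (suc k) = begin
    y * (y * p) + (1# + n) * (y * p)
      ≤⟨ x≤x+y (<⇒≤ (*-pos 0<1 (*-pos (fromℕ-pos (suc k)) (^-pos 0<y k)))) ⟩
    (y * (y * p) + (1# + n) * (y * p)) + 1# * (n * p)
      ≈⟨ solve 4 (λ y o n p →
           (y :* (y :* p) :+ (o :+ n) :* (y :* p)) :+ o :* (n :* p)
           := (y :+ o) :* (y :* p :+ n :* p)) refl y 1# n p ⟩
    (y + 1#) * (y * p + n * p)
      ≤⟨ *-monoʳ-≤ (<-trans 0<y (x<x+y 0<1)) (bernoulli 0<y k) ⟩
    (y + 1#) ^ suc (suc k) ∎
    where
    n = fromℕ (suc k)
    p = y ^ k

  -- Multiplication by `(k + 1)! = (k + 1) k!` clears the denominators and leaves `bernoulli`.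
  expTerm-step : 0# < y → ∀ k →
    expTerm y (suc k) + expTerm y k ≤ expTerm (y + 1#) (suc k)
  expTerm-step {y} 0<y k = *-cancelˡ-≤ (0<! (suc k)) (begin
    F′ * (expTerm y (suc k) + expTerm y k)
      ≈⟨ distribˡ F′ _ _ ⟩
    F′ * expTerm y (suc k) + F′ * expTerm y k
      ≈⟨ +-cong (!*expTerm y (suc k)) (*-congʳ (×1-homo-* (suc k) (k !))) ⟩
    y ^ suc k + (fromℕ (suc k) * fromℕ (k !)) * expTerm y k
      ≈⟨ +-congˡ (trans (*-assoc _ _ _) (*-congˡ (!*expTerm y k))) ⟩
    y ^ suc k + fromℕ (suc k) * y ^ k
      ≤⟨ bernoulli 0<y k ⟩
    (y + 1#) ^ suc k
      ≈⟨ !*expTerm (y + 1#) (suc k) ⟨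
    F′ * expTerm (y + 1#) (suc k) ∎)
    where
    F′ = fromℕ (suc k !)

  expTerm-step-sum : 0# < y → ∀ N →
    sumTo (expTerm y) (suc N) + sumTo (expTerm y) N
      ≤ sumTo (expTerm (y + 1#)) (suc N)
  -- Up to adding 0, both sides are the term of index 0, which does not depend on the argument.
  expTerm-step-sum 0<y zero = ≤-reflexive (+-identityʳ _)
  expTerm-step-sum {y} 0<y (suc N) = begin
    (e (suc N) + a (suc N)) + (e N + a N)
      ≈⟨ solve 4 (λ p q r s → (p :+ q) :+ (r :+ s) := (p :+ r) :+ (q :+ s))
           refl (e (suc N)) (a (suc N)) (e N) (a N) ⟩
    (e (suc N) + e N) + (a (suc N) + a N)
      ≤⟨ +-mono-≤ (expTerm-step-sum 0<y N) (expTerm-step 0<y N) ⟩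
    sumTo (expTerm (y + 1#)) (suc (suc N)) ∎
    where
    a = expTerm y
    e = sumTo a

  exp-doubling : 0# < y → ∀ N →
    2# * sumTo (expTerm y) N ≤ sumTo (expTerm (y + 1#)) (suc N)
  exp-doubling {y} 0<y N = begin
    2# * e N      ≈⟨ 2*x≈x+x (e N) ⟩
    e N + e N     ≤⟨ +-monoˡ-≤ (e N) (x≤x+y (expTerm-nonNeg 0<y N)) ⟩
    e (suc N) + e N ≤⟨ expTerm-step-sum 0<y N ⟩
    sumTo (expTerm (y + 1#)) (suc N) ∎
    where
    e = sumTo (expTerm y)

  1≤exp : 0# < y → ∀ N → 1# ≤ sumTo (expTerm y) (suc N)
  1≤exp {y} 0<y zero = ≤-reflexive (begin-equality
    1#                          ≈⟨ !*expTerm y 0 ⟨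
    (1# + 0#) * expTerm y 0     ≈⟨ *-congʳ (+-identityʳ 1#) ⟩
    1# * expTerm y 0            ≈⟨ *-identityˡ _ ⟩
    expTerm y 0                 ≈⟨ +-identityˡ _ ⟨
    0# + expTerm y 0            ∎)
  1≤exp 0<y (suc N) = ≤-trans (1≤exp 0<y N) (x≤x+y (expTerm-nonNeg 0<y (suc N)))

  -- Lower the argument by 1 `n` times, doubling each time; `fromℕ n < x` keeps it positive
  -- throughout. Each doubling costs one term, and the remaining `suc N` terms include the constant
  -- term 1. Since `N` is free, the bound holds for arbitrarily late partial sums.
  2^n≤exp : ∀ n N → fromℕ n < x → 2# ^ n ≤ sumTo (expTerm x) (n ℕ.+ suc N)
  2^n≤exp zero    N 0<x = 1≤exp 0<x N
  2^n≤exp {x} (suc n) N 1+n<x = begin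
    2# * 2# ^ n
      ≤⟨ *-monoʳ-≤ 0<2 (2^n≤exp n N n<x-1) ⟩
    2# * sumTo (expTerm (x - 1#)) (n ℕ.+ suc N)
      ≤⟨ exp-doubling (≤-<-trans (0≤fromℕ n) n<x-1) (n ℕ.+ suc N) ⟩
    sumTo (expTerm ((x - 1#) + 1#)) (suc (n ℕ.+ suc N))
      ≈⟨ sumTo-cong (suc n ℕ.+ suc N) (λ k _ → expTerm-cong (x-z+z≈x x 1#) k) ⟩
    sumTo (expTerm x) (suc n ℕ.+ suc N) ∎
    where
    n<x-1 : fromℕ n < x - 1#
    n<x-1 = +-cancelʳ-< 1#
      (<-respʳ-≈ (sym (x-z+z≈x x 1#)) (<-respˡ-≈ (+-comm 1# _) 1+n<x))

  -- If `n < l`, late partial sums are at least `2 ^ n`. But they converge to `x`, and with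
  -- tolerance `2 ^ n - x` they must eventually fall below `2 ^ n`.
  log≤ : ∀ {l} n → IsLog l x → x < 2# ^ n → l ≤ fromℕ n
  log≤ {x} {l} n exp-l⟶x x<2^n n<l with exp-l⟶x (2# ^ n - x) (x<y⇒0<y-x x<2^n)
  ... | N , close = <-irrefl refl (begin-strict
    2# ^ n                           ≤⟨ 2^n≤exp n N n<l ⟩
    sumTo (expTerm l) M              ≈⟨ sum-toℕ (expTerm l) M ⟨
    expPartialSum l M                ≈⟨ x-z+z≈x _ x ⟨
    (expPartialSum l M - x) + x
      <⟨ +-monoˡ-< x (proj₁ (close M (ℕ.≤-trans (ℕ.n≤1+n N) (ℕ.m≤n+m _ n)))) ⟩
    (2# ^ n - x) + x                 ≈⟨ x-z+z≈x _ x ⟩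
    2# ^ n                           ∎)
    where
    M = n ℕ.+ suc N

-- Gains and ratios for geometrically growing bids

module GeometricBids (R : RealField) where
  open RealField R hiding (zero)
  open OrderedField R
  open CommutativeRing commutativeRing using (commutativeSemiring)
  open Solver commutativeSemiring using (solve; _:+_; _:*_; _:=_)
  open ≤-Reasoning

  2^-_ : ℕ → ℝ
  2^- n = recip (2# ^ n) (0<2^ n)

  2*2^-suc : ∀ n → 2# * 2^- suc n ≈ 2^- n
  2*2^-suc n = *-cancelˡ-≈ (0<2^ n) (begin-equality
    2# ^ n * (2# * 2^- suc n)
      ≈⟨ solve 3 (λ p t q → p :* (t :* q) := (t :* p) :* q)
           refl (2# ^ n) 2# (2^- suc n) ⟩
    2# ^ suc n * 2^- suc n      ≈⟨ recip-inverseʳ (0<2^ (suc n)) ⟩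
    1#                          ≈⟨ recip-inverseʳ (0<2^ n) ⟨
    2# ^ n * 2^- n              ∎)

  module _ (x : ℕ → ℝ) where

    gain : ℕ → ℝ
    gain = sumTo λ m → 2# ^ m * x m

    -- The competitive ratio on the first `k + 1` items, where OPT is `2 ^ k`.
    gainRatio : ℕ → ℝ
    gainRatio k = 2^- k * gain (suc k)

    -- Exchanging the order of summation, x m has the coefficient
    -- 2 ^ m (2 ^ (- m) + ... + 2 ^ (- (n - 1))) = 2 - 2 ^ (m + 1 - n).
    sum-gainRatio : ∀ n →
      sumTo gainRatio n + 2# * (2^- n * gain n) ≈ 2# * sumTo x n
    sum-gainRatio zero = trans (+-identityˡ _) (*-congˡ (zeroʳ _))
    sum-gainRatio (suc n) = begin-equality
      (S + c * (V + d)) + 2# * (2^- suc n * (V + d))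
        -- Doubling `2^- suc n` gives `c`, so the remainder equals the ratio just added.
        ≈⟨ +-congˡ (trans (sym (*-assoc 2# _ _)) (*-congʳ (2*2^-suc n))) ⟩
      (S + c * (V + d)) + c * (V + d)
        ≈⟨ solve 4 (λ S c V d → (S :+ c :* (V :+ d)) :+ c :* (V :+ d)
             := (S :+ (c :* V :+ c :* V)) :+ (c :* d :+ c :* d)) refl S c V d ⟩
      (S + (c * V + c * V)) + (c * d + c * d)
        ≈⟨ +-cong (+-congˡ (2*x≈x+x _)) (2*x≈x+x _) ⟨
      (S + 2# * (c * V)) + 2# * (c * d)
        ≈⟨ +-cong (sum-gainRatio n) (*-congˡ (recip-cancel (0<2^ n) (x n))) ⟩
      2# * sumTo x n + 2# * x n
        ≈⟨ distribˡ 2# _ _ ⟨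
      2# * sumTo x (suc n) ∎
      where
      S = sumTo gainRatio n
      c = 2^- n
      V = gain n
      d = 2# ^ n * x n

    sum-gainRatio≤2 : ∀ n → (∀ k → k ℕ.< n → 0# ≤ x k) → sumTo x n ≤ 1# →
      sumTo gainRatio n ≤ 2#
    sum-gainRatio≤2 n 0≤x X≤1 = begin
      sumTo gainRatio n
        ≤⟨ x≤x+y (*-nonNeg (<⇒≤ 0<2) (*-nonNeg (<⇒≤ (recip-pos (0<2^ n)))
             (sumTo-nonNeg n λ k k<n → *-nonNeg (<⇒≤ (0<2^ k)) (0≤x k k<n)))) ⟩
      sumTo gainRatio n + 2# * (2^- n * gain n)
        ≈⟨ sum-gainRatio n ⟩
      2# * sumTo x n ≤⟨ *-monoʳ-≤ 0<2 X≤1 ⟩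
      2# * 1#        ≈⟨ *-identityʳ 2# ⟩
      2#             ∎

  -- Serves as the optimal shares: everything goes to the last item.
  kronecker : ℕ → ℕ → ℝ
  kronecker zero    zero    = 1#
  kronecker zero    (suc n) = 0#
  kronecker (suc m) zero    = 0#
  kronecker (suc m) (suc n) = kronecker m n

  kronecker-diag : ∀ n → kronecker n n ≡ 1#
  kronecker-diag zero    = ≡.refl
  kronecker-diag (suc n) = kronecker-diag n

  kronecker-< : ∀ {m n} → m ℕ.< n → kronecker m n ≡ 0#
  kronecker-< {zero}  {suc n} _   = ≡.refl
  kronecker-< {suc m} {suc n} m<n = kronecker-< (s≤s⁻¹ m<n)

  0≤kronecker : ∀ m n → 0# ≤ kronecker m n
  0≤kronecker zero    zero    = <⇒≤ 0<1
  0≤kronecker zero    (suc n) = ≤-refl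
  0≤kronecker (suc m) zero    = ≤-refl
  0≤kronecker (suc m) (suc n) = 0≤kronecker m n

  kronecker≤1 : ∀ m n → kronecker m n ≤ 1#
  kronecker≤1 zero    zero    = ≤-refl
  kronecker≤1 zero    (suc n) = <⇒≤ 0<1
  kronecker≤1 (suc m) zero    = <⇒≤ 0<1
  kronecker≤1 (suc m) (suc n) = kronecker≤1 m n

  sumTo-kronecker : ∀ (f : ℕ → ℝ) n → sumTo (λ m → f m * kronecker m n) (suc n) ≈ f n
  sumTo-kronecker f n = begin-equality
    sumTo (λ m → f m * kronecker m n) n + f n * kronecker n n
      ≈⟨ +-cong (sumTo-cong n λ m m<n →
           trans (*-congˡ (reflexive (kronecker-< m<n))) (zeroʳ (f m)))
           (trans (*-congˡ (reflexive (kronecker-diag n))) (*-identityʳ (f n))) ⟩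
    sumTo (λ _ → 0#) n + f n ≈⟨ +-congʳ (sumTo-zero n) ⟩
    0# + f n                 ≈⟨ +-identityˡ (f n) ⟩
    f n                      ∎

-- Allocations and strategies take the membership proof as an argument; its uniqueness makes a share
-- depend on the item alone.
∈-irrelevant : ∀ {n} {i : Fin n} {p} (e e′ : i ∈ p) → e ≡ e′
∈-irrelevant here      here       = ≡.refl
∈-irrelevant (there e) (there e′) = ≡.cong there (∈-irrelevant e e′)

-- Here the online condition enters: the past met by item `j` is the same whatever the number `n` of
-- items.
take-applyUpTo : ∀ {A : Set} (f : ℕ → A) n (j : Fin (length (applyUpTo f n))) →
                 take (toℕ j) (applyUpTo f n) ≡ applyUpTo f (toℕ j)
take-applyUpTo f (suc n) zero    = ≡.refl
take-applyUpTo f (suc n) (suc j) = ≡.cong (f 0 ∷_) (take-applyUpTo (f ∘ suc) n j)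

-- The hard instances and their optimum

module HardInstances (R : RealField) where
  open RealField R hiding (zero)
  open OrderedField R
  open GeometricBids R
  open OnGAP R
  open CommutativeRing commutativeRing using (+-commutativeMonoid)
  open MonoidSum +-commutativeMonoid using (sum-cong-≋)
  open ≤-Reasoning

  -- Names the summands of ∑, which are local to its definition.
  summands : ∀ {n} {P : Pred (Fin n) 0ℓ} (P? : Decidable P) (f : ∀ k → P k → ℝ) →
             ∃[ u ] ∑ P? f ≡ sum {n} u
  summands P? f = _ , ≡.refl

  ∑-total : ∀ {n} {P : Pred (Fin n) 0ℓ} (P? : Decidable P) {f : ∀ k → P k → ℝ}
            {g : Fin n → ℝ} → (∀ k → P k) → (∀ k p → f k p ≈ g k) → ∑ P? f ≈ sum g
  ∑-total {n} P? {f} {g} total f≈g = sum-cong-≋ {n} {proj₁ (summands P? f)} pointwise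
    where
    pointwise : ∀ k → proj₁ (summands P? f) k ≈ g k
    pointwise k with P? k
    ... | yes p = f≈g k p
    ... | no ¬p = ⊥-elim (¬p (total k))

  doublingItem : ℕ → Item 1
  doublingItem m = record
    { N        = ⊤
    ; bid      = λ _ _ → 2# ^ m
    ; weight   = λ _ _ → 1#
    ; weight>0 = λ _ _ → 0<1
    }

  hard : ℕ → Instance
  hard n = record
    { budget   = λ _ → 1#
    ; budget>0 = λ _ → 0<1
    ; items    = applyUpTo doublingItem n
    }

  module Hard (n : ℕ) where
    open Instance (hard n) public

    length-items : length items ≡ n
    length-items = length-applyUpTo doublingItem n

    toℕ<n′ : ∀ (j : Position) → toℕ j ℕ.< n
    toℕ<n′ j = ≡.subst (toℕ j ℕ.<_) length-items (toℕ<n j)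

    -- The lookup does not compute at a variable position, so facts about `doublingItem` are
    -- transported to `item j`.
    item-elim : ∀ (P : Item 1 → Set) j → P (doublingItem (toℕ j)) → P (item j)
    item-elim P j = ≡.subst P (≡.sym (lookup-applyUpTo doublingItem n j))

    edge : ∀ i j → Edge i j
    edge i j = item-elim (λ t → i ∈ Item.N t) j ∈⊤

    b≈ : ∀ i j e → b i j e ≈ 2# ^ toℕ j
    b≈ i j = item-elim (λ t → ∀ e → Item.bid t i e ≈ 2# ^ toℕ j) j λ _ → refl

    w≈ : ∀ i j e → w i j e ≈ 1#
    w≈ i j = item-elim (λ t → ∀ e → Item.weight t i e ≈ 1#) j λ _ → refl

    module _ (y : Allocation) (z : Position → ℝ) (y≈z : ∀ i j e → y i j e ≈ z j) where

      value≈ : value y ≈ sum λ j → 2# ^ toℕ j * z j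
      value≈ = sum-cong-≋ λ j → trans
        (∑-total (λ i → edge? i j) (λ i → edge i j)
          λ i e → *-cong (b≈ i j e) (y≈z i j e))
        (+-identityʳ _)

      load≈ : ∀ i → ∑ (edge? i) (λ j e → w i j e * y i j e) ≈ sum z
      load≈ i = ∑-total (edge? i) (edge i)
        λ j e → trans (*-cong (w≈ i j e) (y≈z i j e)) (*-identityˡ (z j))

      usage≈ : ∀ j → ∑ (λ i → edge? i j) (λ i e → y i j e) ≈ z j
      usage≈ j = trans
        (∑-total (λ i → edge? i j) (λ i → edge i j) λ i e → y≈z i j e)
        (+-identityʳ _)

    sum-Position : ∀ f → sum {length items} (f ∘ toℕ) ≈ sumTo f n
    sum-Position f = trans (sum-toℕ f (length items))
      (reflexive (≡.cong (sumTo f) length-items))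

    -- With one buyer and unique edge proofs, an allocation amounts to one share per item.
    canonical : Allocation → Position → ℝ
    canonical y j = y zero j (edge zero j)

    canonical≈ : ∀ y i j e → y i j e ≈ canonical y j
    canonical≈ y zero j e = reflexive (≡.cong (y zero j) (∈-irrelevant e (edge zero j)))

    inClass : ∀ {η} → (∀ m → m ℕ.< n → 2# ^ m ≤ η) → InClass η (hard n)
    inClass {η} 2^≤η i j e =
      (begin
        w i j e    ≈⟨ w≈ i j e ⟩
        1#         ≤⟨ 2^-mono-≤ {0} {toℕ j} ℕ.z≤n ⟩
        2# ^ toℕ j ≈⟨ b≈ i j e ⟨
        b i j e    ∎) ,
      (begin
        b i j e     ≈⟨ b≈ i j e ⟩
        2# ^ toℕ j  ≤⟨ 2^≤η (toℕ j) (toℕ<n′ j) ⟩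
        η           ≈⟨ *-identityʳ η ⟨
        η * 1#      ≈⟨ *-congˡ (w≈ i j e) ⟨
        η * w i j e ∎)

  -- The value `2 ^ n` is attained by spending the whole budget on the last item. It cannot be
  -- exceeded: no bid is larger, and with unit weights the shares add up to at most 1.
  isOPT : ∀ n → Instance.IsOPT (hard (suc n)) (2# ^ n)
  isOPT n = record
    { attained   = lastOnly , feasible , value-lastOnly
    ; upperBound = upperBound
    }
    where
    open Hard (suc n)

    δ : Position → ℝ
    δ j = kronecker (toℕ j) n

    lastOnly : Allocation
    lastOnly i j e = δ j

    value-lastOnly : value lastOnly ≈ 2# ^ n
    value-lastOnly = trans (value≈ lastOnly δ λ _ _ _ → refl)
      (trans (sum-Position λ m → 2# ^ m * kronecker m n)
             (sumTo-kronecker (2# ^_) n))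

    sum-δ : sum δ ≈ 1#
    sum-δ = begin-equality
      sum δ
        ≈⟨ sum-cong-≋ (λ j → *-identityˡ (δ j)) ⟨
      sum (λ j → 1# * δ j)
        ≈⟨ sum-Position (λ m → 1# * kronecker m n) ⟩
      sumTo (λ m → 1# * kronecker m n) (suc n)
        ≈⟨ sumTo-kronecker (λ _ → 1#) n ⟩
      1# ∎

    feasible : Feasible lastOnly
    feasible = record
      { nonNegative  = λ _ j _ → 0≤kronecker (toℕ j) n
      ; withinBudget = λ i → ≤-reflexive
          (trans (load≈ lastOnly δ (λ _ _ _ → refl) i) sum-δ)
      ; atMostOnce   = λ j → ≤-respˡ-≈
          (sym (usage≈ lastOnly δ (λ _ _ _ → refl) j)) (kronecker≤1 (toℕ j) n)
      }

    upperBound : ∀ y → Feasible y → value y ≤ 2# ^ n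
    upperBound y y-feasible = begin
      value y
        ≈⟨ value≈ y z (canonical≈ y) ⟩
      sum (λ j → 2# ^ toℕ j * z j)
        ≤⟨ sum-mono-≤ (λ j → *-monoˡ-≤-nonNeg (nonNegative zero j (edge zero j))
             (2^-mono-≤ {toℕ j} {n} (s≤s⁻¹ (toℕ<n′ j)))) ⟩
      sum (λ j → 2# ^ n * z j)
        ≈⟨ *-distribˡ-sum (2# ^ n) z ⟨
      2# ^ n * sum z
        ≈⟨ *-congˡ (load≈ y z (canonical≈ y) zero) ⟨
      2# ^ n * ∑ (edge? zero) (λ j e → w zero j e * y zero j e)
        ≤⟨ *-monoʳ-≤ (0<2^ n) (withinBudget zero) ⟩
      2# ^ n * 1#
        ≈⟨ *-identityʳ _ ⟩
      2# ^ n ∎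
      where
      open Feasible y-feasible
      z = canonical y

  -- A fixed strategy on all prefixes

  module _ (decide : Strategy) where

    -- On every hard instance with more than m items, item m meets the same
    -- past, so this is its share on all of them.
    share : ℕ → ℝ
    share m = decide (λ _ → 1#) (applyUpTo doublingItem m) (doublingItem m) zero ∈⊤

    run≈share : ∀ n i j e → run decide (hard n) i j e ≈ share (toℕ j)
    run≈share n zero j e = reflexive (decide-cong {m = toℕ j}
      (take-applyUpTo doublingItem n j) (lookup-applyUpTo doublingItem n j) e)
      where
      -- The type of `e` depends on the item, so past and item are generalised to variables before
      -- their equations are matched.
      decide-cong : ∀ {past past′ t m} → past ≡ past′ → t ≡ doublingItem m →
        (e : zero ∈ Item.N t) →
        decide (λ _ → 1#) past t zero e
          ≡ decide (λ _ → 1#) past′ (doublingItem m) zero ∈⊤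
      decide-cong ≡.refl ≡.refl e =
        ≡.cong (decide _ _ _ zero) (∈-irrelevant e ∈⊤)

    value-run : ∀ n → Instance.value (hard n) (run decide (hard n)) ≈ gain share n
    value-run n = trans
      (Hard.value≈ n (run decide (hard n)) (share ∘ toℕ) (run≈share n))
      (Hard.sum-Position n λ m → 2# ^ m * share m)

    -- Feasibility on the longest instance controls all the prefixes at once, since they receive the
    -- same shares.
    sum-ratios≤2 : ∀ n → Instance.Feasible (hard n) (run decide (hard n)) →
      sum {n} (λ k → 2^- toℕ k *
        Instance.value (hard (suc (toℕ k))) (run decide (hard (suc (toℕ k)))))
        ≤ 2#
    sum-ratios≤2 n feasible = begin
      sum {n} (λ k → 2^- toℕ k *
        Instance.value (hard (suc (toℕ k))) (run decide (hard (suc (toℕ k)))))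
        ≈⟨ sum-cong-≋ {n} (λ k → *-congˡ (value-run (suc (toℕ k)))) ⟩
      sum {n} (gainRatio share ∘ toℕ)
        ≈⟨ sum-toℕ (gainRatio share) n ⟩
      sumTo (gainRatio share) n
        ≤⟨ sum-gainRatio≤2 share n share-nonNeg shares≤1 ⟩
      2# ∎
      where
      open Hard n
      open Feasible feasible

      shares≤1 : sumTo share n ≤ 1#
      shares≤1 = ≤-respˡ-≈
        (trans (load≈ (run decide (hard n)) (share ∘ toℕ) (run≈share n) zero)
               (sum-Position share))
        (withinBudget zero)

      share-nonNeg : ∀ k → k ℕ.< n → 0# ≤ share k
      share-nonNeg k k<n = ≡.subst (λ m → 0# ≤ share m) (toℕ-fromℕ< k<length)
        (≤-trans (nonNegative zero j (edge zero j))
                 (≤-reflexive (run≈share n zero j (edge zero j))))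
        where
        k<length : k ℕ.< length items
        k<length = ≡.subst (k ℕ.<_) (≡.sym length-items) k<n
        j : Position
        j = fromℕ< k<length

  -- Passing to expectations

  module _ (Ω : Randomness) where
    open Randomness Ω

    -- Integrability is returned along with the equation because `𝔼` takes its proof as an argument.
    𝔼-sum : ∀ {n} {f : Fin n → Outcome → ℝ} (p : ∀ k → Integrable (f k)) →
      Σ (Integrable λ ω → sum λ k → f k ω) λ q → 𝔼 _ q ≈ sum λ k → 𝔼 _ (p k)
    𝔼-sum {zero}  p = const-int 0# , 𝔼-const 0#
    𝔼-sum {suc n} p with 𝔼-sum (p ∘ suc)
    ... | q , 𝔼q≈ = +-int (p zero) q , trans (𝔼-+ (p zero) q) (+-congˡ 𝔼q≈)

    -- By linearity and monotonicity, a bound valid for every seed carries over to the expected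
    -- values; this reduces randomized algorithms to deterministic ones.
    𝔼-weightedSum≤ : ∀ {n} {f : Fin n → Outcome → ℝ} (p : ∀ k → Integrable (f k))
      (c : Fin n → ℝ) {B} → (∀ ω → sum (λ k → c k * f k ω) ≤ B) →
      sum (λ k → c k * 𝔼 _ (p k)) ≤ B
    𝔼-weightedSum≤ p c {B} bound with 𝔼-sum (λ k → *-int (c k) (p k))
    ... | q , 𝔼q≈ = begin
      sum (λ k → c k * 𝔼 _ (p k))      ≈⟨ sum-cong-≋ (λ k → 𝔼-* (c k) (p k)) ⟨
      sum (λ k → 𝔼 _ (*-int (c k) (p k))) ≈⟨ 𝔼q≈ ⟨
      𝔼 _ q                            ≤⟨ 𝔼-mono q (const-int B) bound ⟩
      𝔼 _ (const-int B)                ≈⟨ 𝔼-const B ⟩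
      B                                ∎

-- Averaging the expected ratios over the prefixes

theorem6 : (R : RealField) → let open RealField R in let open OnGAP R in
    ∃[ C ] 0# < C ×
    (∀ η → 1# < η → ∀ logη → IsLog logη η → (0<logη : 0# < logη) →
    (A : OnlineAlgorithm η) → Inf Ratios A AtMost (C / logη [ 0<logη ]))
-- The constant is 4: one factor 2 bounds the sum of the ratios, the other comes from
-- `K + 2 <= 2 (K + 1)`.
theorem6 R = 2# * 2# , *-pos 0<2 0<2 , smallRatio
  where
  open RealField R hiding (zero)
  open OnGAP R
  open OrderedField R
  open Logarithm R
  open GeometricBids R
  open HardInstances R
  open CommutativeRing commutativeRing
    using (commutativeSemiring; +-commutativeMonoid)
  open MonoidSum +-commutativeMonoid using (sum-cong-≋; sum-replicate)
  open Mult semiring using (×-assoc-*; ×-congʳ)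
  open Solver commutativeSemiring using (solve; _:+_; _:*_; _:=_)
  open ≤-Reasoning

  sum-const : ∀ n x → sum {n} (λ _ → x) ≈ fromℕ n * x
  sum-const n x = begin-equality
    sum {n} (λ _ → x) ≈⟨ sum-replicate n ⟩
    n ⨰ x             ≈⟨ ×-congʳ n (*-identityˡ x) ⟨
    n ⨰ (1# * x)      ≈⟨ ×-assoc-* n 1# x ⟨
    fromℕ n * x       ∎

  2≤[1+K]*4/l : ∀ K {l} (0<l : 0# < l) → l ≤ fromℕ (2 ℕ.+ K) →
    2# ≤ fromℕ (suc K) * ((2# * 2#) / l [ 0<l ])
  2≤[1+K]*4/l K {l} 0<l l≤2+K = *-cancelˡ-≤ 0<l (begin
    l * 2#                    ≈⟨ *-comm l 2# ⟩
    2# * l                    ≤⟨ *-monoʳ-≤ 0<2 l≤2+K ⟩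
    2# * (1# + k)             ≤⟨ *-monoʳ-≤ 0<2 (+-monoˡ-≤ k (x≤x+y (0≤fromℕ K))) ⟩
    2# * (k + k)              ≈⟨ *-congˡ (2*x≈x+x k) ⟨
    2# * (2# * k)             ≈⟨ *-identityˡ _ ⟨
    1# * (2# * (2# * k))      ≈⟨ *-congʳ (recip-inverseʳ 0<l) ⟨
    (l * r) * (2# * (2# * k)) ≈⟨ solve 4 (λ l r t k → (l :* r) :* (t :* (t :* k))
                                   := l :* (k :* ((t :* t) :* r))) refl l r 2# k ⟩
    l * (k * ((2# * 2#) * r)) ∎)
    where
    k = fromℕ (suc K)
    r = recip l 0<l

  smallRatio : ∀ η → 1# < η → ∀ logη → IsLog logη η → (0<logη : 0# < logη) →
    (A : OnlineAlgorithm η) → Inf Ratios A AtMost ((2# * 2#) / logη [ 0<logη ])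
  smallRatio η 1<η l exp-l 0<l A ε 0<ε with dyadicBounds η 1<η
  ... | K , 2^K<η , η<2^[2+K] = conclude (sum-<⇒∃-< ratio (λ _ → c + ε) sum<)
    where
    open OnlineAlgorithm A
    c = (2# * 2#) / l [ 0<l ]

    hard∈ : ∀ n → n ℕ.≤ suc K → InClass η (hard n)
    hard∈ n n≤1+K = Hard.inClass n λ m m<n →
      ≤-trans (2^-mono-≤ {m} {K} (s≤s⁻¹ (ℕ.≤-trans m<n n≤1+K))) (<⇒≤ 2^K<η)

    prefix∈ : (k : Fin (suc K)) → InClass η (hard (suc (toℕ k)))
    prefix∈ k = hard∈ (suc (toℕ k)) (toℕ<n k)

    alg : Fin (suc K) → ℝ
    alg k = ALG (hard (suc (toℕ k))) (prefix∈ k)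

    ratio : Fin (suc K) → ℝ
    ratio k = alg k / 2# ^ toℕ k [ 0<2^ (toℕ k) ]

    sum-ratio≤2 : sum ratio ≤ 2#
    sum-ratio≤2 = ≤-respˡ-≈ (sum-cong-≋ {suc K} λ k → *-comm (2^- toℕ k) (alg k))
      (𝔼-weightedSum≤ randomness
        (λ k → integrable (hard (suc (toℕ k))) (prefix∈ k)) (λ k → 2^- toℕ k)
        λ ω → sum-ratios≤2 (strategy ω) (suc K)
          (feasible ω (hard (suc K)) (hard∈ (suc K) ℕ.≤-refl)))

    sum< : sum ratio < sum {suc K} (λ _ → c + ε)
    sum< = begin-strict
      sum ratio                 ≤⟨ sum-ratio≤2 ⟩
      2#                        ≤⟨ 2≤[1+K]*4/l K 0<l (log≤ (2 ℕ.+ K) exp-l η<2^[2+K]) ⟩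
      -- The slack `ε` supplies the strict inequality from which `sum-<⇒∃-<` extracts a prefix.
      fromℕ (suc K) * c         <⟨ *-monoʳ-< (fromℕ-pos (suc K)) (x<x+y 0<ε) ⟩
      fromℕ (suc K) * (c + ε)   ≈⟨ sum-const (suc K) (c + ε) ⟨
      sum {suc K} (λ _ → c + ε) ∎

    conclude : ∃[ k ] ratio k < c + ε → ∃[ s ] Ratios A s × s < c + ε
    conclude (k , small) = ratio k ,
      (hard (suc (toℕ k)) , prefix∈ k , 2# ^ toℕ k , isOPT (toℕ k) , 0<2^ (toℕ k) , refl) ,
      small
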